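{- Let $n\in\mathbb{N}$ and let $X\subseteq\mathbb{N}$ be a finite set with $\min X\ge 3$. If $X$ is $\omega^{300n}$-large, then $X$ is $\mathrm{RT}^{2}_{2}$-$\omega^{n}$-large: for every colouring $P:[X]^2\to 2$ there is an $\omega^n$-large set $Y\subseteq X$ that is $P$-homogeneous.
   Context: Ordinals $\alpha<\omega^\omega$ are written in Cantor normal form $\alpha=\omega^{n_0}+\dots+\omega^{n_{k-1}}$ with $n_0\ge\dots\ge n_{k-1}$; $1=\omega^0$ and $\omega^n\cdot k$ denotes the sum of $k$ copies of $\omega^n$. For $m\in\mathbb{N}$ define $0[m]=0$, $(\beta+1)[m]=\beta$, and $(\beta+\omega^{n})[m]=\beta+\omega^{n-1}\cdot m$ for $n\ge 1$ (where $\beta+\omega^n$ is in Cantor normal form). A finite set $X=\{x_0<\dots<x_{\ell-1}\}\subseteq\mathbb{N}$ is $\alpha$-large if $\alpha[x_0][x_1]\cdots[x_{\ell-1}]=0$. A finite set $X$ is $\mathrm{RT}^2_2$-$\alpha$-large if for every $P:[X]^2\to 2$ there is an $\alpha$-large $P$-homogeneous $Y\subseteq X$. -}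

module Defs where

open import Data.Fin.Base using (Fin)
open import Data.List.Base using (List; []; _∷_; _++_; replicate; foldl)
open import Data.List.Membership.Propositional using (_∈_)
open import Data.List.Relation.Binary.Subset.Propositional using () renaming (_⊆_ to _⊆ᴸ_)
open import Data.List.Relation.Unary.All using (All; []; _∷_)
import Data.List.Relation.Unary.All as All
open import Data.List.Relation.Unary.AllPairs using (AllPairs; []; _∷_)
open import Data.List.Relation.Unary.All.Properties using (++⁺; replicate⁺)
open import Data.Nat.Base using (ℕ; zero; suc; _≤_; _<_)
open import Data.Nat.Properties using (≤-refl; <⇒≤)
open import Data.Product.Base using (Σ; ∃; _×_)
open import Relation.Binary.PropositionalEquality using (_≡_)

-- An ordinal below ω^ω in Cantor normal form ω^n₀ + … + ω^nₖ₋₁, given by the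
-- list of its exponents from the last term to the first, nₖ₋₁ ∷ … ∷ n₀ ∷ [];
-- the condition n₀ ≥ … ≥ nₖ₋₁ says that this list is nondecreasing.
record Ordinal : Set where
  constructor mkOrdinal
  field
    exponents : List ℕ
    .ordered  : AllPairs _≤_ exponents

open Ordinal public

𝟎 : Ordinal
𝟎 = mkOrdinal [] []

infix 9 ω^_

ω^_ : ℕ → Ordinal
ω^ n = mkOrdinal (n ∷ []) ([] ∷ [])

ordered-tail : ∀ {n ns} → AllPairs _≤_ (n ∷ ns) → AllPairs _≤_ ns
ordered-tail (_ ∷ o) = o

ordered-replicate : ∀ m {n ns} → AllPairs _≤_ (suc n ∷ ns) → AllPairs _≤_ (replicate m n ++ ns)
ordered-replicate zero    (_ ∷ o) = o
ordered-replicate (suc m) (b ∷ o) =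
  ++⁺ (replicate⁺ m ≤-refl) (All.map <⇒≤ b) ∷ ordered-replicate m (b ∷ o)

infixl 8 _[_]

_[_] : Ordinal → ℕ → Ordinal
mkOrdinal []           _ [ m ] = 𝟎
mkOrdinal (zero  ∷ ns) o [ m ] = mkOrdinal ns (ordered-tail o)
mkOrdinal (suc n ∷ ns) o [ m ] = mkOrdinal (replicate m n ++ ns) (ordered-replicate m o)

record FiniteSet : Set where
  constructor mkFiniteSet
  field
    elements   : List ℕ
    increasing : AllPairs _<_ elements

open FiniteSet public

infix 4 _⊆_

_⊆_ : FiniteSet → FiniteSet → Set
Y ⊆ X = elements Y ⊆ᴸ elements X

-- foldl applies the elements in increasing order: α [ x₀ ] [ x₁ ] … [ xₗ₋₁ ].
Large : Ordinal → FiniteSet → Set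
Large α X = foldl _[_] α (elements X) ≡ 𝟎

-- Two-element subsets {lower < upper} of X. The proofs are irrelevant, so that
-- a function on [ X ]² depends only on the two elements.
record [_]² (X : FiniteSet) : Set where
  constructor mkPair
  field
    lower upper    : ℕ
    .lower∈        : lower ∈ elements X
    .upper∈        : upper ∈ elements X
    .lower<upper   : lower < upper

include : ∀ {X Y} → Y ⊆ X → [ Y ]² → [ X ]²
include Y⊆X (mkPair x y x∈ y∈ x<y) = mkPair x y (Y⊆X x∈) (Y⊆X y∈) x<y

Homogeneous : ∀ {X Y} → ([ X ]² → Fin 2) → Y ⊆ X → Set
Homogeneous {X} {Y} P Y⊆X = ∃ λ c → (e : [ Y ]²) → P (include {X} {Y} Y⊆X e) ≡ c

RT²₂-Large : Ordinal → FiniteSet → Set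
RT²₂-Large α X =
  (P : [ X ]² → Fin 2) →
  Σ FiniteSet λ Y → Σ (Y ⊆ X) λ Y⊆X →
    Large α Y × Homogeneous {X} {Y} P Y⊆X

{-# OPTIONS --safe #-}
module Submission where

-- An ω^n-large set contains a tree of height n in which a node x has x children.
-- The heart of the proof is: from a tree of height m + 24 one can extract an element x
-- and x successive sets G₁ < … < Gₓ above it, each containing a tree of height m, such
-- that all pairs between different ones of {x}, G₁, …, Gₓ have one colour c.  By
-- induction on a + b, height 24 (a + b) then yields a homogeneous tree of height a in
-- colour 0 or of height b in colour 1: apply the induction hypothesis to each Gᵢ, with
-- the target for colour c lowered by one; either some Gᵢ already meets the target for
-- the other colour, or the trees found in the Gᵢ join under the root x.
--
-- For the extraction, let the least element x₀ see everything in colour c.  Making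
-- successive blocks homogeneous over all earlier elements either gives blocks pairwise
-- of colour c, or an element x₁ seeing a large set in the other colour.  In the second
-- case x₁ blocks of that set which are pairwise of one colour, found by the finite
-- Ramsey theorem, fit under x₀ or under x₁.  Homogeneity over earlier elements is a
-- pigeonhole principle with 2^(min X) colours, which costs only 5 levels of the tree.

open import Defs
open import Data.Nat.Base using (ℕ; zero; suc; _+_; _*_; _^_; _≤_; _<_; z≤n; s≤s; s≤s⁻¹)
open import Data.Nat.Properties
open import Data.Nat.Solver using (module +-*-Solver)
open import Algebra.Properties.Monoid.Sum +-0-monoid using () renaming (sum to ∑)
open import Data.Empty using (⊥-elim-irr)
open import Data.Fin.Base using (Fin; zero; suc; funToFin; finToFun)
open import Data.Fin.Patterns using (0F; 1F)
import Data.Fin.Properties as Fin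
open import Data.List.Base using (List; []; _∷_; _++_; length; replicate; concat; foldl; filter; lookup; take)
open import Data.List.Membership.DecPropositional _≟_ using (_∈?_)
open import Data.List.Membership.Propositional using (_∈_)
open import Data.List.Properties using (++-assoc; ++-identityʳ; length-++; length-replicate; length-filter; length-take; filter-++; filter-none; filter-accept; filter-reject)
open import Data.List.Relation.Binary.Sublist.Propositional using ([]; _∷_; _∷ʳ_; minimum; from∈) renaming (_⊆_ to _⊑_; ⊆-refl to ⊑-refl; ⊆-trans to ⊑-trans; ⊆-reflexive to ⊑-reflexive)
import Data.List.Relation.Binary.Sublist.Propositional.Properties as Sub
open import Data.List.Relation.Unary.All using (All; []; _∷_)
import Data.List.Relation.Unary.All as All
import Data.List.Relation.Unary.All.Properties as All
open import Data.List.Relation.Unary.AllPairs using (AllPairs; []; _∷_)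
import Data.List.Relation.Unary.AllPairs.Properties as AllPairs
open import Data.List.Relation.Unary.Any using (here; there; index)
open import Data.List.Relation.Unary.Any.Properties using (lookup-index)
open import Data.Product.Base using (Σ; ∃; ∃₂; _×_; _,_; proj₁; proj₂)
open import Data.Sum.Base as Sum using (_⊎_; inj₁; inj₂)
open import Data.Vec.Functional using (updateAt)
open import Data.Vec.Functional.Properties using (updateAt-updates; updateAt-minimal)
open import Function.Base using (id; _∘_)
open import Relation.Binary.PropositionalEquality using (_≡_; _≢_; refl; sym; trans; cong; subst; module ≡-Reasoning)
open import Relation.Nullary using (¬_; yes; no; contradiction; recompute)

private variable
  b c k m n x y : ℕ
  ns L W X Y Z : List ℕ
  Bs Gs : List (List ℕ)
  f : ℕ → ℕ

-- Increasing lists and sublists.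

infixr 5 _∷_

-- The index `b` carries a lower bound on all entries, on which the growth estimates operate.
data Increasing : ℕ → List ℕ → Set where
  []  : Increasing b []
  _∷_ : b ≤ x → Increasing (suc x) X → Increasing b (x ∷ X)

increasing-weaken : c ≤ b → Increasing b X → Increasing c X
increasing-weaken c≤b []      = []
increasing-weaken c≤b (p ∷ I) = ≤-trans c≤b p ∷ I

increasing-⊑ : Y ⊑ X → Increasing b X → Increasing b Y
increasing-⊑ []         []      = []
increasing-⊑ (_ ∷ʳ s)   (p ∷ I) = increasing-weaken (m≤n⇒m≤1+n p) (increasing-⊑ s I)
increasing-⊑ (refl ∷ s) (p ∷ I) = p ∷ increasing-⊑ s I

increasing-++ˡ : ∀ X → Increasing b (X ++ Y) → Increasing b X
increasing-++ˡ X = increasing-⊑ (Sub.++⁺ʳ _ ⊑-refl)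

increasing-++ʳ : ∀ X → Increasing b (X ++ Y) → Increasing b Y
increasing-++ʳ X = increasing-⊑ (Sub.++⁺ˡ X ⊑-refl)

increasing-length : ∀ X → Increasing b (X ++ Y) → Increasing (length X + b) Y
increasing-length []      I       = I
increasing-length {b} (x ∷ X) (p ∷ I) =
  increasing-weaken (subst (_≤ length X + suc x) (+-suc (length X) b) (+-monoʳ-≤ (length X) (s≤s p)))
    (increasing-length X I)

pairs-increasing : All (b ≤_) X → AllPairs _<_ X → Increasing b X
pairs-increasing []      []      = []
pairs-increasing (p ∷ _) (q ∷ P) = p ∷ pairs-increasing q P

concat-⊑ : {As Bs : List (List ℕ)} → As ⊑ Bs → concat As ⊑ concat Bs
concat-⊑ []         = []
concat-⊑ (B ∷ʳ s)   = Sub.++⁺ˡ B (concat-⊑ s)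
concat-⊑ (refl ∷ s) = Sub.++⁺ ⊑-refl (concat-⊑ s)

increasing-concat : Increasing b (concat Bs) → All (Increasing b) Bs
increasing-concat {Bs = []}     I = []
increasing-concat {Bs = B ∷ Bs} I = increasing-++ˡ B I ∷ increasing-concat (increasing-++ʳ B I)

middle-⊑ : ∀ L → Y ⊑ X → (L ++ Y) ++ Z ⊑ L ++ X ++ Z
middle-⊑ {Y} {Z = Z} L s = ⊑-trans (⊑-reflexive (++-assoc L Y Z)) (Sub.++⁺ (⊑-refl {x = L}) (Sub.++⁺ s ⊑-refl))

-- Large sets as trees and forests.

-- For f = id these are the minimal ω^n-large sets.
data Tree (f : ℕ → ℕ) : ℕ → List ℕ → Set where
  leaf : Tree f 0 (x ∷ [])
  node : length Bs ≡ f x → All (Tree f n) Bs → Tree f (suc n) (x ∷ concat Bs)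

-- As in the exponent list, the last term of the ordinal comes first: it is reduced first, by the
-- smallest elements.
data Forest (f : ℕ → ℕ) : List ℕ → List ℕ → Set where
  []  : Forest f [] []
  _∷_ : Tree f n X → Forest f ns Y → Forest f (n ∷ ns) (X ++ Y)

forest-split : ∀ k → Forest f (replicate k n ++ ns) X →
  ∃₂ λ Bs Y → length Bs ≡ k × All (Tree f n) Bs × Forest f ns Y × concat Bs ++ Y ≡ X
forest-split zero    F = [] , _ , refl , [] , F , refl
forest-split (suc k) (_∷_ {X = B} T F) with forest-split k F
... | Bs , Y , eq , Ts , G , refl = B ∷ Bs , Y , cong suc eq , T ∷ Ts , G , ++-assoc B (concat Bs) Y

forest-singleton : Forest f (n ∷ []) X → Tree f n X
forest-singleton (_∷_ {X = X} T []) = subst (Tree _ _) (sym (++-identityʳ X)) T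

forest-graft : ∀ x n → Forest f (replicate (f x) n ++ ns) X → Forest f (suc n ∷ ns) (x ∷ X)
forest-graft {f} x n F with forest-split (f x) F
... | Bs , Y , eq , Ts , G , refl = node eq Ts ∷ G

tree-nonempty : Tree f n X → ∃ λ x → x ∈ X
tree-nonempty leaf       = _ , here refl
tree-nonempty (node _ _) = _ , here refl

-- Each reduction grafts its element as a root onto the forest of the rest. Elements left over once
-- the ordinal is 0 are dropped, whence a sublist.
large⇒forest : ∀ ns .{o} X → foldl _[_] (mkOrdinal ns o) X ≡ 𝟎 → ∃ λ Y → Y ⊑ X × Forest id ns Y
large⇒forest []          X       eq = [] , minimum X , []
large⇒forest (n ∷ ns)    []      ()
large⇒forest (zero ∷ ns) (x ∷ X) eq with large⇒forest ns X eq
... | Y , s , F = x ∷ Y , refl ∷ s , leaf ∷ F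
large⇒forest (suc n ∷ ns) (x ∷ X) eq with large⇒forest (replicate x n ++ ns) X eq
... | Y , s , F = x ∷ Y , refl ∷ s , forest-graft x n F

-- Further terms `ns` and further elements `W` are allowed so that the children of a node can be
-- treated one after the other.
tree-reduces : Tree id n X → ∀ ns .{o} .{o′} W →
  foldl _[_] (mkOrdinal (n ∷ ns) o) (X ++ W) ≡ foldl _[_] (mkOrdinal ns o′) W
trees-reduce : ∀ k → length Bs ≡ k → All (Tree id n) Bs → ∀ ns .{o} .{o′} W →
  foldl _[_] (mkOrdinal (replicate k n ++ ns) o) (concat Bs ++ W) ≡ foldl _[_] (mkOrdinal ns o′) W
tree-reduces leaf ns W = refl
tree-reduces (node {x = x} eq Ts) ns W = trees-reduce x eq Ts ns W
trees-reduce zero refl [] ns W = refl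
trees-reduce {B ∷ Bs} {n} (suc k) eq (T ∷ Ts) ns {o} W
  rewrite ++-assoc B (concat Bs) W =
  trans (tree-reduces T (replicate k n ++ ns) {o} {ordered-tail o} (concat Bs ++ W))
        (trees-reduce k (suc-injective eq) Ts ns W)

tree⇒large : ∀ n .{o} → Tree id n X → foldl _[_] (mkOrdinal (n ∷ []) o) X ≡ 𝟎
tree⇒large {X} n {o} T =
  trans (cong (foldl _[_] (mkOrdinal (n ∷ []) o)) (sym (++-identityʳ X))) (tree-reduces T [] [])

-- Passing to the first child loses one level; it exists because roots are at least 1.
tree-lower : ∀ k → Increasing 1 X → Tree id (k + n) X → ∃ λ Y → Y ⊑ X × Tree id n Y
tree-lower zero    I T = _ , ⊑-refl , T
tree-lower (suc k) (p ∷ I) (node {Bs = B ∷ Bs} eq (T ∷ Ts))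
  with tree-lower k (increasing-weaken (s≤s z≤n) (increasing-++ˡ B I)) T
... | Y , s , U = Y , _ ∷ʳ Sub.++⁺ʳ (concat Bs) s , U
tree-lower (suc k) (() ∷ I) (node {Bs = []} refl [])

-- Growth of the elements that follow a tree.

1≤2^ : ∀ n → 1 ≤ 2 ^ n
1≤2^ = m^n>0 2

n<2^n : ∀ n → n < 2 ^ n
n<2^n zero    = s≤s z≤n
n<2^n (suc n) = begin
  suc (suc n)         ≤⟨ +-mono-≤ (1≤2^ n) (n<2^n n) ⟩
  2 ^ n + 2 ^ n       ≡⟨ cong (2 ^ n +_) (+-identityʳ (2 ^ n)) ⟨
  2 ^ suc n           ∎
  where open ≤-Reasoning

2^-mono : m ≤ n → 2 ^ m ≤ 2 ^ n
2^-mono = ^-monoʳ-≤ 2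

3+n≤2^n : 3 ≤ n → 3 + n ≤ 2 ^ n
3+n≤2^n {suc n} 3≤n with m≤n⇒m<n∨m≡n 3≤n
... | inj₂ refl = s≤s (s≤s (s≤s (s≤s (s≤s (s≤s z≤n)))))
... | inj₁ 3<n = begin
  3 + suc n      ≡⟨ +-suc 3 n ⟩
  1 + (3 + n)    ≤⟨ +-mono-≤ (1≤2^ n) (3+n≤2^n (s≤s⁻¹ 3<n)) ⟩
  2 ^ n + 2 ^ n  ≡⟨ cong (2 ^ n +_) (+-identityʳ (2 ^ n)) ⟨
  2 ^ suc n      ∎
  where open ≤-Reasoning

n+n≤2^n : 3 ≤ n → n + n ≤ 2 ^ n
n+n≤2^n {suc n} 3≤n with m≤n⇒m<n∨m≡n 3≤n
... | inj₂ refl = 3+n≤2^n ≤-refl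
... | inj₁ 3<n = begin
  suc n + suc n    ≡⟨ cong suc (+-suc n n) ⟩
  2 + (n + n)      ≤⟨ +-mono-≤ (≤-trans (s≤s (s≤s z≤n)) (3+n≤2^n (s≤s⁻¹ 3<n))) (n+n≤2^n (s≤s⁻¹ 3<n)) ⟩
  2 ^ n + 2 ^ n    ≡⟨ cong (2 ^ n +_) (+-identityʳ (2 ^ n)) ⟨
  2 ^ suc n        ∎
  where open ≤-Reasoning

leaves-length : All (Tree f 0) Bs → length (concat Bs) ≡ length Bs
leaves-length []          = refl
leaves-length (leaf ∷ Ts) = cong suc (leaves-length Ts)

-- A tree of height 1 is a root `x` with `x` leaves, so what follows it is at least `x + suc x`.
growth₁ : Tree id 1 X → Increasing b (X ++ W) → Increasing (2 * b) W
growth₁ {b = b} (node {Bs = Bs} {x = x} eq Ts) (p ∷ I) =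
  increasing-weaken le (increasing-length (concat Bs) I)
  where
  le : 2 * b ≤ length (concat Bs) + suc x
  le rewrite leaves-length Ts | eq | +-identityʳ b = +-mono-≤ p (m≤n⇒m≤1+n p)

growth₁-iterated : All (Tree id 1) Bs → Increasing b (concat Bs ++ W) → Increasing (2 ^ length Bs * b) W
growth₁-iterated {b = b} [] I = increasing-weaken (≤-reflexive (+-identityʳ b)) I
growth₁-iterated {B ∷ Bs} {b} {W} (T ∷ Ts) I
  rewrite ++-assoc B (concat Bs) W | *-comm 2 (2 ^ length Bs) | *-assoc (2 ^ length Bs) 2 b =
  growth₁-iterated Ts (growth₁ T I)

-- At height 2 the root `x` has `x` children, each of which doubles the bound. At larger heights the
-- first child suffices.
growth₂ : Tree id (2 + n) X → 1 ≤ b → Increasing b (X ++ W) → Increasing (2 ^ b) W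
growth₂ {zero} {b = b} (node {Bs = Bs} {x = x} eq Ts) 1≤b (p ∷ I) =
  increasing-weaken le (growth₁-iterated Ts I)
  where
  le : 2 ^ b ≤ 2 ^ length Bs * suc x
  le rewrite eq = ≤-trans (2^-mono p) (m≤m*n (2 ^ x) (suc x))
growth₂ {suc n} (node {Bs = []} refl []) 1≤b (p ∷ I) with ≤-trans 1≤b p
... | ()
growth₂ {suc n} {W = W} (node {Bs = B ∷ Bs} eq (T ∷ Ts)) 1≤b (p ∷ I)
  rewrite ++-assoc B (concat Bs) W =
  increasing-++ʳ (concat Bs) (growth₂ T 1≤b (increasing-weaken (m≤n⇒m≤1+n p) I))

-- The first two children of the root each exponentiate the bound.
growth₃ : Tree id (3 + n) X → 2 ≤ b → Increasing b (X ++ W) → Increasing (2 ^ 2 ^ b) W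
growth₃ (node {Bs = []} refl []) 2≤b (p ∷ I) with ≤-trans 2≤b p
... | ()
growth₃ (node {Bs = B ∷ []} refl (T ∷ [])) 2≤b (p ∷ I) with ≤-trans 2≤b p
... | s≤s ()
growth₃ {b = b} {W = W} (node {Bs = B ∷ C ∷ Bs} eq (T ∷ U ∷ Ts)) 2≤b (p ∷ I)
  rewrite ++-assoc B (C ++ concat Bs) W | ++-assoc C (concat Bs) W =
  increasing-++ʳ (concat Bs)
    (growth₂ U (1≤2^ b) (growth₂ T (<⇒≤ 2≤b) (increasing-weaken (m≤n⇒m≤1+n p) I)))

-- Sparse trees.

-- Chosen to exceed the total number of terms present after reducing at x, which
-- is at most 2 ^ suc x when it is at most 2 ^ x before (total-step-2^).
sparse : ℕ → ℕ
sparse x = suc (2 ^ suc x)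

sparse-bound : 3 ≤ x → sparse x + sparse x ≤ 2 ^ 2 ^ x
sparse-bound {x} 3≤x = begin
  sparse x + sparse x                ≤⟨ +-mono-≤ le le ⟩
  2 ^ (2 + x) + 2 ^ (2 + x)          ≡⟨ cong (2 ^ (2 + x) +_) (+-identityʳ (2 ^ (2 + x))) ⟨
  2 ^ (3 + x)                        ≤⟨ 2^-mono (3+n≤2^n 3≤x) ⟩
  2 ^ 2 ^ x                          ∎
  where
  open ≤-Reasoning
  le : sparse x ≤ 2 ^ (2 + x)
  le = begin
    1 + 2 ^ suc x               ≤⟨ +-monoˡ-≤ (2 ^ suc x) (1≤2^ (suc x)) ⟩
    2 ^ suc x + 2 ^ suc x       ≡⟨ cong (2 ^ suc x +_) (+-identityʳ (2 ^ suc x)) ⟨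
    2 ^ (2 + x)                 ∎

-- The root of `X` gives way to the much smaller `y`: its children number at least
-- `sparse y + sparse y`, and joined in pairs they supply the children of `y`.
sparse-root : ∀ n → 3 ≤ y → Increasing (sparse y + sparse y) X → Tree id (3 + n) X →
  ∃ λ Y → Y ⊑ X × Tree sparse n (y ∷ Y)
-- Of two neighbouring trees the first keeps only its root `y`. The rest of it pushes the second
-- tree beyond `2 ^ 2 ^ y`, far enough for that tree to be hung below `y`.
sparse-pairs : ∀ n k → 3 ≤ b → Increasing b (concat Bs) → All (Tree id (3 + n)) Bs → k + k ≤ length Bs →
  ∃ λ Gs → length Gs ≡ k × concat Gs ⊑ concat Bs × All (Tree sparse n) Gs
sparse-root zero 3≤y I T = [] , minimum _ , leaf
sparse-root {y = y} (suc n) 3≤y (p ∷ I) (node {x = x} eq Ts)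
  with sparse-pairs n (sparse y) (≤-trans 3≤x (n≤1+n x)) I Ts (≤-trans p (≤-reflexive (sym eq)))
  where
  3≤x : 3 ≤ x
  3≤x = begin
    3                     ≤⟨ 3≤y ⟩
    y                     ≤⟨ <⇒≤ (n<2^n y) ⟩
    2 ^ y                 ≤⟨ 2^-mono (n≤1+n y) ⟩
    2 ^ suc y             ≤⟨ n≤1+n _ ⟩
    sparse y              ≤⟨ m≤m+n (sparse y) (sparse y) ⟩
    sparse y + sparse y   ≤⟨ p ⟩
    x                     ∎
    where open ≤-Reasoning
... | Gs , eq′ , s , Us = concat Gs , _ ∷ʳ s , node eq′ Us
sparse-pairs n zero    3≤b I Ts le = [] , refl , minimum _ , []
sparse-pairs {b} {B ∷ []} n (suc k) 3≤b I Ts le rewrite +-suc k k with le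
... | s≤s ()
sparse-pairs {b} {(y ∷ B) ∷ C ∷ Bs} n (suc k) 3≤b (p ∷ I) (T@(node _ _) ∷ U ∷ Ts) le
  with sparse-root n 3≤y (increasing-++ˡ C (increasing-weaken (sparse-bound 3≤y) J)) U
     | sparse-pairs n k 3≤b (increasing-weaken (m≤n⇒m≤1+n p) (increasing-++ʳ C (increasing-++ʳ B I))) Ts le′
  where
  3≤y = ≤-trans 3≤b p
  J : Increasing (2 ^ 2 ^ y) (C ++ concat Bs)
  J = growth₃ T (<⇒≤ 3≤y) (≤-refl ∷ I)
  le′ : k + k ≤ length Bs
  le′ rewrite +-suc k k = s≤s⁻¹ (s≤s⁻¹ le)
... | Y , s , V | Gs , eq , t , Vs =
  (y ∷ Y) ∷ Gs , cong suc eq , refl ∷ Sub.++⁺ˡ B (Sub.++⁺ s t) , V ∷ Vs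

sparse-subtree : 3 ≤ b → Increasing b X → Tree id (4 + n) X → ∃ λ Y → Y ⊑ X × Tree sparse n Y
sparse-subtree {n = n} 3≤b (p ∷ I) (node {x = x} eq Ts)
  -- A single pair of children of the root gives the sparse tree.
  with sparse-pairs n 1 3≤b (increasing-weaken (m≤n⇒m≤1+n p) I) Ts
         (≤-trans (s≤s (s≤s z≤n)) (≤-trans 3≤b (≤-trans p (≤-reflexive (sym eq)))))
... | (Y ∷ []) , refl , s , (T ∷ []) = Y , _ ∷ʳ subst (_⊑ _) (++-identityʳ Y) s , T

-- Counting the terms of several ordinals under reduction.

∑-updateAt : {A : Set} (μ : A → ℕ) (s : Fin k → A) (i : Fin k) (g : A → A) →
  ∑ (μ ∘ updateAt s i g) + μ (s i) ≡ ∑ (μ ∘ s) + μ (g (s i))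
∑-updateAt μ s zero    g = solve 3 (λ a b c → (a :+ b) :+ c := (c :+ b) :+ a) refl
  (μ (g (s zero))) (∑ (μ ∘ s ∘ suc)) (μ (s zero))
  where open +-*-Solver
∑-updateAt μ s (suc i) g =
  trans (+-assoc (μ (s zero)) _ _)
    (trans (cong (μ (s zero) +_) (∑-updateAt μ (s ∘ suc) i g)) (sym (+-assoc (μ (s zero)) _ _)))

∑-mono : {s t : Fin k → ℕ} → (∀ i → s i ≤ t i) → ∑ s ≤ ∑ t
∑-mono {zero}  le = z≤n
∑-mono {suc k} le = +-mono-≤ (le zero) (∑-mono (le ∘ suc))

∑-ones : ∀ k → ∑ {k} (λ _ → 1) ≡ k
∑-ones zero    = refl
∑-ones (suc k) = cong suc (∑-ones k)

-- The fundamental sequence `_[_]` on bare exponent lists.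
reduce : ℕ → List ℕ → List ℕ
reduce x []           = []
reduce x (zero  ∷ ns) = ns
reduce x (suc n ∷ ns) = replicate x n ++ ns

reduce-length : ∀ x ns → length (reduce x ns) ≤ x + length ns
reduce-length x []           = z≤n
reduce-length x (zero ∷ ns)  = m≤n⇒m≤o+n x (n≤1+n _)
reduce-length x (suc n ∷ ns) rewrite length-++ (replicate x n) {ns} | length-replicate x {n} =
  +-monoʳ-≤ x (n≤1+n _)

reduce-bound : ∀ x → All (_< n) ns → All (_< n) (reduce x ns)
reduce-bound x []                  = []
reduce-bound x (_∷_ {zero}  p ps)  = ps
reduce-bound x (_∷_ {suc e} p ps)  = All.++⁺ (All.replicate⁺ x (<-trans (n<1+n e) p)) ps

occurrences : ℕ → List ℕ → ℕ
occurrences n = length ∘ filter (_≟ n)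

occurrences-reduce : ∀ x n ns →
  occurrences n (reduce x (n ∷ ns)) ≡ occurrences n ns
occurrences-reduce x zero    ns = refl
occurrences-reduce x (suc n) ns
  rewrite filter-++ (_≟ suc n) (replicate x n) ns
        | filter-none (_≟ suc n) (All.replicate⁺ x (<⇒≢ (n<1+n n))) = refl

occurrences-reduce-< : ∀ x {e} ns → e < n →
  occurrences n (reduce x (e ∷ ns)) ≡ occurrences n (e ∷ ns)
occurrences-reduce-< {n} x {zero}  ns e<n rewrite filter-reject (_≟ n) {xs = ns} (<⇒≢ e<n) = refl
occurrences-reduce-< {n} x {suc e} ns e<n
  rewrite filter-++ (_≟ n) (replicate x e) ns
        | filter-none (_≟ n) (All.replicate⁺ x (<⇒≢ (<-trans (n<1+n e) e<n)))
        | filter-reject (_≟ n) {xs = ns} (<⇒≢ e<n) = refl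

-- The pigeonhole principle for trees.

-- The colour classes are reduced simultaneously: each colour carries its own
-- ordinal, which is reduced by the elements of that colour only.
module _ (col : ℕ → Fin k) where

  State : Set
  State = Fin k → List ℕ

  step : State → ℕ → State
  step s x = updateAt s (col x) (reduce x)

  total : State → ℕ
  total s = ∑ (length ∘ s)

  terms : ℕ → State → ℕ
  terms n s = ∑ (occurrences n ∘ s)

  terms≤total : ∀ n s → terms n s ≤ total s
  terms≤total n s = ∑-mono (λ i → length-filter (_≟ n) (s i))

  total-step : ∀ s x → total (step s x) ≤ x + total s
  total-step s x = +-cancelʳ-≤ (length (s (col x))) _ _ (begin
    total (step s x) + length (s (col x))        ≡⟨ ∑-updateAt length s (col x) (reduce x) ⟩
    total s + length (reduce x (s (col x)))      ≤⟨ +-monoʳ-≤ (total s) (reduce-length x (s (col x))) ⟩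
    total s + (x + length (s (col x)))           ≡⟨ +-assoc (total s) x _ ⟨
    total s + x + length (s (col x))             ≡⟨ cong (_+ length (s (col x))) (+-comm (total s) x) ⟩
    x + total s + length (s (col x))             ∎)
    where open ≤-Reasoning

  -- Preserves the invariant of a run: while the elements to come are at least `b`, there are at
  -- most `2 ^ b` terms.
  total-step-2^ : ∀ s {b x} → b ≤ x → total s ≤ 2 ^ b → total (step s x) ≤ 2 ^ suc x
  total-step-2^ s {b} {x} b≤x le = begin
    total (step s x)   ≤⟨ total-step s x ⟩
    x + total s        ≤⟨ +-mono-≤ (<⇒≤ (n<2^n x)) (≤-trans le (2^-mono b≤x)) ⟩
    2 ^ x + 2 ^ x      ≡⟨ cong (2 ^ x +_) (+-identityʳ (2 ^ x)) ⟨
    2 ^ suc x          ∎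
    where open ≤-Reasoning

  -- Every element has to spend a term of its colour, and only one with exponent below `n`.
  data Quiet (n : ℕ) : State → List ℕ → Set where
    []   : ∀ {s} → Quiet n s []
    cons : ∀ {s x X e ns} → s (col x) ≡ e ∷ ns → e < n → Quiet n (step s x) X → Quiet n s (x ∷ X)

  quiet-++⁻ : ∀ {s} X → Quiet n s (X ++ Y) → Quiet n s X × Quiet n (foldl step s X) Y
  quiet-++⁻ []      Q = [] , Q
  quiet-++⁻ (x ∷ X) (cons eq lt Q) with quiet-++⁻ X Q
  ... | Q₁ , Q₂ = cons eq lt Q₁ , Q₂

  total-run : ∀ {s} X → Increasing b (X ++ Y) → total s ≤ 2 ^ b →
    ∃ λ c → Increasing c Y × total (foldl step s X) ≤ 2 ^ c
  total-run []      I       le = _ , I , le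
  total-run {s = s} (x ∷ X) (p ∷ I) le = total-run X I (total-step-2^ s p le)

  terms-step-≡ : ∀ {s x ns} → s (col x) ≡ n ∷ ns → suc (terms n (step s x)) ≡ terms n s
  terms-step-≡ {n} {s} {x} {ns} eq with ∑-updateAt (occurrences n) s (col x) (reduce x)
  ... | h rewrite eq | occurrences-reduce x n ns | filter-accept (_≟ n) {xs = ns} (refl {x = n}) =
    +-cancelʳ-≡ (occurrences n ns) _ _ (trans (sym (+-suc _ _)) h)

  terms-step-< : ∀ {s x e ns} → s (col x) ≡ e ∷ ns → e < n → terms n (step s x) ≡ terms n s
  terms-step-< {n} {s} {x} {e} {ns} eq lt with ∑-updateAt (occurrences n) s (col x) (reduce x)
  ... | h rewrite eq | occurrences-reduce-< x ns lt = +-cancelʳ-≡ (occurrences n (e ∷ ns)) _ _ h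

  -- As no exponent above `n` is reduced, terms with exponent `n` are never created, and each
  -- reduction of one destroys it.
  quiet-descent : ∀ {s} → Quiet (suc n) s X →
    Quiet n s X × terms n (foldl step s X) ≡ terms n s ⊎ terms n (foldl step s X) < terms n s
  quiet-descent [] = inj₁ ([] , refl)
  quiet-descent {n} {x ∷ X} {s} (cons {e = e} eq lt Q) with m≤n⇒m<n∨m≡n (s≤s⁻¹ lt) | quiet-descent Q
  ... | inj₁ e<n  | inj₁ (Q′ , h) = inj₁ (cons eq e<n Q′ , trans h (terms-step-< eq e<n))
  ... | inj₁ e<n  | inj₂ h        = inj₂ (<-≤-trans h (≤-reflexive (terms-step-< eq e<n)))
  ... | inj₂ refl | inj₁ (_ , h)  = inj₂ (≤-reflexive (trans (cong suc h) (terms-step-≡ eq)))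
  ... | inj₂ refl | inj₂ h        = inj₂ (≤-trans h (≤-trans (n≤1+n _) (≤-reflexive (terms-step-≡ eq))))

  -- While no exponent ≥ n + 1 is reduced, each of the subtrees of height n consumes
  -- a term with exponent n, and there are more subtrees than terms.
  sparse-not-quiet : ∀ n {s} → Increasing b X → total s ≤ 2 ^ b → Tree sparse n X → ¬ Quiet n s X
  subtrees-consume : ∀ n {s} → Increasing b (concat Bs) → total s ≤ 2 ^ b → All (Tree sparse n) Bs →
    Quiet (suc n) s (concat Bs) → length Bs ≤ terms n s
  sparse-not-quiet zero    I le leaf (cons _ () _)
  sparse-not-quiet (suc n) {s} (p ∷ I) le (node {Bs = Bs} {x = x} eq Ts) (cons _ _ Q) =
    <-irrefl refl (begin-strict
      2 ^ suc x            <⟨ n<1+n _ ⟩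
      sparse x             ≡⟨ eq ⟨
      length Bs            ≤⟨ subtrees-consume n I le′ Ts Q ⟩
      terms n (step s x)   ≤⟨ terms≤total n (step s x) ⟩
      total (step s x)     ≤⟨ le′ ⟩
      2 ^ suc x            ∎)
    where
    open ≤-Reasoning
    le′ = total-step-2^ s p le
  subtrees-consume n I le [] Q = z≤n
  subtrees-consume {Bs = B ∷ Bs} n {s} I le (T ∷ Ts) Q with quiet-++⁻ B Q | total-run {s = s} B I le
  ... | Q₁ , Q₂ | c , J , le′ with quiet-descent Q₁
  ...   | inj₁ (Q′ , _) = contradiction Q′ (sparse-not-quiet n (increasing-++ˡ B I) le T)
  ...   | inj₂ h        = ≤-trans (s≤s (subtrees-consume n J le′ Ts Q₂)) h

  -- A run can only be stopped by an element whose colour already has ordinal 0. Going back from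
  -- there, the earlier elements of that colour are grafted into a forest and the others skipped.
  monochromatic-or-quiet : ∀ {s} X → (∀ i → All (_< n) (s i)) →
    (∃₂ λ i Y → Y ⊑ X × All (λ y → col y ≡ i) Y × Forest id (s i) Y) ⊎ Quiet n s X
  monochromatic-or-quiet []      bd = inj₂ []
  monochromatic-or-quiet {n} {s} (x ∷ X) bd with s (col x) in eq
  ... | []     = inj₁ (col x , [] , minimum _ , [] , subst (λ ns → Forest id ns []) (sym eq) [])
  ... | e ∷ ns with monochromatic-or-quiet {n} {step s x} X bd′
    where
    bd′ : ∀ i → All (_< n) (step s x i)
    bd′ i with i Fin.≟ col x
    ... | yes refl rewrite updateAt-updates (col x) {reduce x} s = reduce-bound x (bd (col x))
    ... | no  i≢   rewrite updateAt-minimal i (col x) {reduce x} s i≢ = bd i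
  ...   | inj₂ Q = inj₂ (cons eq (All.head (subst (All (_< n)) eq (bd (col x)))) Q)
  ...   | inj₁ (i , Y , sub , mono , F) with i Fin.≟ col x
  ...     | no i≢    = inj₁ (i , Y , x ∷ʳ sub , mono ,
                             subst (λ ns → Forest id ns Y) (updateAt-minimal i (col x) s i≢) F)
  ...     | yes refl = inj₁ (col x , x ∷ Y , refl ∷ sub , refl ∷ mono ,
                             subst (λ ns → Forest id ns (x ∷ Y)) (sym eq) (unreduce e
                               (subst (λ ns → Forest id ns Y)
                                 (trans (updateAt-updates (col x) s) (cong (reduce x) eq)) F)))
    where
    unreduce : ∀ e → Forest id (reduce x (e ∷ ns)) Y → Forest id (e ∷ ns) (x ∷ Y)
    unreduce zero    F = leaf ∷ F
    unreduce (suc e) F = forest-graft x e F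

  -- Every colour starts with `ω^ m`, which makes `k` terms in all. A sparse tree of height `suc m`
  -- excludes a quiet run, and making the tree sparse costs the four other levels.
  pigeonhole : 3 ≤ b → k ≤ 2 ^ b → Increasing b X → Tree id (5 + m) X →
    ∃₂ λ i Y → Y ⊑ X × Tree id m Y × All (λ y → col y ≡ i) Y
  pigeonhole {m = m} 3≤b k≤ I T with sparse-subtree 3≤b I T
  ... | Z , s , U with monochromatic-or-quiet {s = λ _ → m ∷ []} Z (λ _ → n<1+n m ∷ [])
  ...   | inj₂ Q = contradiction Q (sparse-not-quiet (suc m) (increasing-⊑ s I)
                     (≤-trans (≤-reflexive (∑-ones _)) k≤) U)
  ...   | inj₁ (i , Y , t , mono , F) = i , Y , ⊑-trans t s , forest-singleton F , mono

-- Pigeonhole applied to the vector of colours that `y` has with the elements of `L`, coded as one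
-- of `2 ^ length L` colours.
homogenize : (Q : ℕ → ℕ → Fin 2) (L : List ℕ) → 3 ≤ b → length L ≤ b → Increasing b X → Tree id (5 + m) X →
  ∃ λ Y → Y ⊑ X × Tree id m Y × All (λ x → ∃ λ c → All (λ y → Q x y ≡ c) Y) L
homogenize Q L 3≤b len I T with pigeonhole type 3≤b (2^-mono len) I T
  where
  type : ℕ → Fin (2 ^ length L)
  type y = funToFin (λ j → Q (lookup L j) y)
... | i , Y , s , U , mono = Y , s , U , All.tabulate λ {x} x∈L →
  finToFun i (index x∈L) , All.map (λ {y} eq → begin
    Q x y                                                                    ≡⟨ cong (λ z → Q z y) (lookup-index x∈L) ⟩
    Q (lookup L (index x∈L)) y                                               ≡⟨ Fin.finToFun-funToFin (λ j → Q (lookup L j) y) (index x∈L) ⟨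
    finToFun (funToFin (λ j → Q (lookup L j) y)) (index x∈L)                 ≡⟨ cong (λ z → finToFun z (index x∈L)) eq ⟩
    finToFun i (index x∈L)                                                   ∎) mono
  where open ≡-Reasoning

-- The finite Ramsey theorem for two colours.

allPairs-⊑ : {A : Set} {R : A → A → Set} {xs ys : List A} → ys ⊑ xs → AllPairs R xs → AllPairs R ys
allPairs-⊑ []         []       = []
allPairs-⊑ (_ ∷ʳ s)   (_ ∷ rs) = allPairs-⊑ s rs
allPairs-⊑ (refl ∷ s) (r ∷ rs) = Sub.All-resp-⊆ s r ∷ allPairs-⊑ s rs

module _ {A : Set} {R : Fin 2 → A → A → Set} where

  split-by-colour : ∀ {x xs} → All (λ y → ∃ λ c → R c x y) xs →
    ∃₂ λ ys zs → ys ⊑ xs × zs ⊑ xs × All (R 0F x) ys × All (R 1F x) zs × length xs ≡ length ys + length zs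
  split-by-colour [] = [] , [] , [] , [] , [] , [] , refl
  split-by-colour (_∷_ {y} (c , r) rs) with c | split-by-colour rs
  ... | zero     | ys , zs , s , t , p , q , eq = y ∷ ys , zs , refl ∷ s , y ∷ʳ t , r ∷ p , q , cong suc eq
  ... | suc zero | ys , zs , s , t , p , q , eq =
    ys , y ∷ zs , y ∷ʳ s , refl ∷ t , p , r ∷ q , trans (cong suc eq) (sym (+-suc (length ys) (length zs)))

  -- Induction on `k + l`: one of the two colour classes of the first vertex has at least half of
  -- `2 ^ (k + l)` members. Colours are relations because the vertices will be blocks, with `Cross`
  -- for `R`.
  ramsey : ∀ k l {xs} → 2 ^ (k + l) ≤ length xs → AllPairs (λ x y → ∃ λ c → R c x y) xs →
    (∃ λ ys → ys ⊑ xs × k ≤ length ys × AllPairs (R 0F) ys) ⊎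
    (∃ λ ys → ys ⊑ xs × l ≤ length ys × AllPairs (R 1F) ys)
  ramsey zero    l       le rs = inj₁ ([] , minimum _ , z≤n , [])
  ramsey (suc k) zero    le rs = inj₂ ([] , minimum _ , z≤n , [])
  ramsey (suc k) (suc l) {[]} le rs = contradiction (≤-trans (1≤2^ (suc k + suc l)) le) λ ()
  ramsey (suc k) (suc l) {x ∷ xs} le (r ∷ rs) with split-by-colour r
  ... | ys , zs , s , t , p , q , eq with <-≤-connex (length ys) (2 ^ (k + suc l))
  ...   | inj₂ le′ with ramsey k (suc l) le′ (allPairs-⊑ s rs)
  ...     | inj₁ (us , u , len , h) = inj₁ (x ∷ us , refl ∷ ⊑-trans u s , s≤s len , Sub.All-resp-⊆ u p ∷ h)
  ...     | inj₂ (us , u , len , h) = inj₂ (us , x ∷ʳ ⊑-trans u s , len , h)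
  ramsey (suc k) (suc l) {x ∷ xs} le (r ∷ rs)
      | ys , zs , s , t , p , q , eq | inj₁ lt with ramsey (suc k) l le′ (allPairs-⊑ t rs)
    where
    le″ : 2 ^ (k + suc l) ≤ length zs
    le″ = +-cancelˡ-≤ (2 ^ (k + suc l)) _ _ (begin
      2 ^ (k + suc l) + 2 ^ (k + suc l)   ≡⟨ cong (2 ^ (k + suc l) +_) (+-identityʳ (2 ^ (k + suc l))) ⟨
      2 ^ suc (k + suc l)                 ≤⟨ le ⟩
      suc (length xs)                     ≡⟨ cong suc eq ⟩
      -- The vertex `x` itself is counted by `suc`; the strict bound on `ys` absorbs it.
      suc (length ys) + length zs         ≤⟨ +-monoˡ-≤ (length zs) lt ⟩
      2 ^ (k + suc l) + length zs         ∎)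
      where open ≤-Reasoning
    le′ : 2 ^ (suc k + l) ≤ length zs
    le′ = subst (λ e → 2 ^ e ≤ length zs) (+-suc k l) le″
  ...     | inj₁ (us , u , len , h) = inj₁ (us , x ∷ʳ ⊑-trans u t , len , h)
  ...     | inj₂ (us , u , len , h) = inj₂ (x ∷ us , refl ∷ ⊑-trans u t , s≤s len , Sub.All-resp-⊆ u q ∷ h)

-- Extraction of a root and blocks with one cross colour.

two-colours : {c d e : Fin 2} → d ≢ c → e ≢ d → e ≡ c
two-colours {zero}     {zero}     d≢c e≢d = contradiction refl d≢c
two-colours {suc zero} {suc zero} d≢c e≢d = contradiction refl d≢c
two-colours {zero}     {suc zero} {zero}     d≢c e≢d = refl
two-colours {zero}     {suc zero} {suc zero} d≢c e≢d = contradiction refl e≢d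
two-colours {suc zero} {zero}     {zero}     d≢c e≢d = contradiction refl e≢d
two-colours {suc zero} {zero}     {suc zero} d≢c e≢d = refl

all-or : {A D : Set} {Q : A → Set} {xs : List A} → All (λ x → Q x ⊎ D) xs → All Q xs ⊎ D
all-or []            = inj₁ []
all-or (inj₂ d ∷ _)  = inj₂ d
all-or (inj₁ q ∷ qs) = Sum.map₁ (q ∷_) (all-or qs)

module _ (P : ℕ → ℕ → Fin 2) where

  Mono : Fin 2 → ℕ → List ℕ → Set
  Mono c x Y = All (λ y → P x y ≡ c) Y

  Cross : Fin 2 → List ℕ → List ℕ → Set
  Cross c X Y = All (λ x → Mono c x Y) X

  cross-or-exception : ∀ c → All (λ x → ∃ λ d → Mono d x Y) L →
    Cross c L Y ⊎ (∃₂ λ x d → x ∈ L × d ≢ c × Mono d x Y)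
  cross-or-exception c [] = inj₁ []
  cross-or-exception c ((d , h) ∷ hs) with d Fin.≟ c | cross-or-exception c hs
  ... | no d≢c   | _                             = inj₂ (_ , d , here refl , d≢c , h)
  ... | yes _    | inj₂ (x , e , x∈ , e≢c , h′)  = inj₂ (x , e , there x∈ , e≢c , h′)
  ... | yes refl | inj₁ hs′                      = inj₁ (h ∷ hs′)

  -- `L` collects the elements of the blocks thinned so far. The first of them to see a later block
  -- in a colour other than `c` ends the sweep.
  sweep : ∀ c L Bs → 3 ≤ b → Increasing b (L ++ concat Bs) → All (Tree id (5 + m)) Bs →
    (∃₂ λ x Y → ∃ λ d → d ≢ c × (x ∷ Y) ⊑ L ++ concat Bs × Tree id m Y × Mono d x Y) ⊎
    (∃ λ Gs → length Gs ≡ length Bs × concat Gs ⊑ concat Bs × All (Tree id m) Gs ×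
       AllPairs (Cross c) Gs × All (Cross c L) Gs)
  sweep c L []       3≤b I []       = inj₂ ([] , refl , [] , [] , [] , [])
  sweep {b} c L (B ∷ Bs) 3≤b I (T ∷ Ts)
    -- The elements after `L` are at least `length L + b`, so the pigeonhole has room for all of
    -- `L`.
    with homogenize P L (m≤n⇒m≤o+n (length L) 3≤b) (m≤m+n (length L) b)
           (increasing-++ˡ B (increasing-length L I)) T
  ... | Y , s , U , hs with cross-or-exception c hs
  ...   | inj₂ (x , d , x∈L , d≢c , h) =
    inj₁ (x , Y , d , d≢c , Sub.++⁺ (from∈ x∈L) (Sub.++⁺ʳ (concat Bs) s) , U , h)
  ...   | inj₁ hL with sweep c (L ++ Y) Bs 3≤b (increasing-⊑ (middle-⊑ L s) I) Ts
  ...     | inj₁ (x , Z , d , d≢c , t , V , h) =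
    inj₁ (x , Z , d , d≢c , ⊑-trans t (middle-⊑ L s) , V , h)
  ...     | inj₂ (Gs , len , t , Vs , pairs , hG) =
    inj₂ (Y ∷ Gs , cong suc len , Sub.++⁺ s t , U ∷ Vs , All.map (All.++⁻ʳ L) hG ∷ pairs ,
          hL ∷ All.map (All.++⁻ˡ L) hG)

  -- Each `x` sees the whole of `Y` in a single colour, and one element `h` reveals which.
  mono-common : All (λ x → ∃ λ d → Mono d x Y) X → ∀ {h c} → h ∈ Y → All (λ x → P x h ≡ c) X → Cross c X Y
  mono-common []             h∈ []       = []
  mono-common ((d , m) ∷ ms) h∈ (e ∷ es) =
    All.map (λ eq → trans eq (trans (sym (All.lookup m h∈)) e)) m ∷ mono-common ms h∈ es

  representatives : All (Tree id m) Gs → List ℕ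
  representatives []       = []
  representatives (T ∷ Ts) = proj₁ (tree-nonempty T) ∷ representatives Ts

  representatives-length : (Ts : All (Tree id m) Gs) → length (representatives Ts) ≡ length Gs
  representatives-length []       = refl
  representatives-length (T ∷ Ts) = cong suc (representatives-length Ts)

  cross-representatives : (Ts : All (Tree id m) Gs) → All (λ G → All (λ x → ∃ λ d → Mono d x G) X) Gs →
    All (λ h → ∃ λ c → All (λ x → P x h ≡ c) X) (representatives Ts) → All (λ G → ∃ λ c → Cross c X G) Gs
  cross-representatives []       []       []             = []
  cross-representatives (T ∷ Ts) (h ∷ hs) ((c , e) ∷ es) =
    (c , mono-common h (proj₂ (tree-nonempty T)) e) ∷ cross-representatives Ts hs es

  -- Five levels make a block homogeneous over each earlier element, in a colour that may vary with
  -- that element. Five more thin the earlier block according to its colours with one representative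
  -- of each later block; there are at most `b` of these.
  pairwise-homogenize : ∀ L Bs → 3 ≤ b → length Bs ≤ b → Increasing b (L ++ concat Bs) → All (Tree id (10 + m)) Bs →
    ∃ λ Gs → length Gs ≡ length Bs × concat Gs ⊑ concat Bs × All (Tree id m) Gs ×
      AllPairs (λ G H → ∃ λ c → Cross c G H) Gs × All (λ G → All (λ x → ∃ λ c → Mono c x G) L) Gs
  pairwise-homogenize L []       3≤b len I []       = [] , refl , [] , [] , [] , []
  pairwise-homogenize {b} L (B ∷ Bs) 3≤b len I (T ∷ Ts)
    with homogenize P L (m≤n⇒m≤o+n (length L) 3≤b) (m≤m+n (length L) b)
           (increasing-++ˡ B (increasing-length L I)) T
  ... | Y , s , U , hL
    with pairwise-homogenize (L ++ Y) Bs 3≤b (<⇒≤ len)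
           (increasing-⊑ (middle-⊑ L s) I) Ts
  ... | Gs , len′ , t , Vs , pairs , hG
    with homogenize (λ h x → P x h) (representatives Vs) 3≤b
           (≤-trans (≤-reflexive (trans (representatives-length Vs) len′)) (<⇒≤ len))
           (increasing-⊑ s (increasing-++ˡ B (increasing-++ʳ L I))) U
  ... | Z , u , V , hR =
    Z ∷ Gs , cong suc len′ , Sub.++⁺ (⊑-trans u s) t , V ∷ Vs ,
    cross-representatives Vs (All.map (Sub.All-resp-⊆ u ∘ All.++⁻ʳ L) hG) hR ∷ pairs ,
    All.map (λ (c , h) → c , Sub.All-resp-⊆ u h) hL ∷ All.map (All.++⁻ˡ L) hG

  -- The first child only serves growth: it raises the root `w` of the second to `2 ^ 2 ^ b`, enough
  -- blocks for Ramsey. The twelve levels are two descents and the ten of `pairwise-homogenize`.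
  homogeneous-groups : 3 ≤ b → Increasing b X → Tree id (12 + m) X →
    ∃₂ λ c Gs → b ≤ length Gs × concat Gs ⊑ X × All (Tree id m) Gs × AllPairs (Cross c) Gs
  homogeneous-groups 3≤b (p ∷ I) (node {Bs = []} refl []) = contradiction (≤-trans 3≤b p) λ ()
  homogeneous-groups 3≤b (p ∷ I) (node {Bs = B ∷ []} refl (_ ∷ [])) = contradiction (≤-trans 3≤b p) λ { (s≤s ()) }
  homogeneous-groups {b} 3≤b (p ∷ I) (node {Bs = B ∷ (w ∷ _) ∷ Bs} eq (T ∷ node {Bs = Cs} eq′ Us ∷ Ts))
    with growth₃ T (<⇒≤ 3≤b) (increasing-weaken (m≤n⇒m≤1+n p) I)
  ... | q ∷ J
    with pairwise-homogenize [] Cs 3≤w (≤-trans (≤-reflexive eq′) (n≤1+n w)) (increasing-++ˡ (concat Cs) J) Us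
    where
    3≤w : 3 ≤ suc w
    3≤w = ≤-trans 3≤b (≤-trans (<⇒≤ (n<2^n b)) (≤-trans (<⇒≤ (n<2^n (2 ^ b))) (m≤n⇒m≤1+n q)))
  ... | Gs , len , s , Vs , pairs , _ = merge (ramsey {R = Cross} b b enough pairs)
    where
    enough : 2 ^ (b + b) ≤ length Gs
    enough = begin
      2 ^ (b + b)   ≤⟨ 2^-mono (n+n≤2^n 3≤b) ⟩
      2 ^ 2 ^ b     ≤⟨ q ⟩
      w             ≡⟨ eq′ ⟨
      length Cs     ≡⟨ len ⟨
      length Gs     ∎
      where open ≤-Reasoning
    sub : ∀ {Hs} → Hs ⊑ Gs → concat Hs ⊑ _
    sub t = _ ∷ʳ Sub.++⁺ˡ B (w ∷ʳ Sub.++⁺ʳ (concat Bs) (⊑-trans (concat-⊑ t) s))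
    merge : _ ⊎ _ → _
    merge (inj₁ (Hs , t , len , h)) = 0F , Hs , len , sub t , Sub.All-resp-⊆ t Vs , h
    merge (inj₂ (Hs , t , len , h)) = 1F , Hs , len , sub t , Sub.All-resp-⊆ t Vs , h

  Contains : ℕ → List ℕ → Set
  Contains n X = ∃ λ Y → Y ⊑ X × Tree id n Y

  -- The levels add up as 24 = 1 + 5 + 1 + 5 + 12: the root `x`, homogeneity over `x`, the root `z`,
  -- the sweep, and `homogeneous-groups`.
  rooted-groups : Increasing 3 X → Tree id (24 + m) X →
    ∃₂ λ c x → ∃ λ Gs → x ≤ length Gs × (x ∷ concat Gs) ⊑ X × All (Contains m) Gs ×
      AllPairs (Cross c) Gs × Mono c x (concat Gs)
  rooted-groups (p ∷ I) (node {Bs = []} refl []) = contradiction p λ ()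
  rooted-groups {m = m} (p ∷ I) (node {Bs = B ∷ Bs} {x = x} _ (T ∷ _))
    with homogenize P (x ∷ []) (m≤n⇒m≤1+n p) (s≤s z≤n) (increasing-++ˡ B I) T
  ... | _ , s , node {Bs = Cs} {x = z} eq Us , (c , h) ∷ []
    with increasing-⊑ s (increasing-++ˡ B I)
  ... | q ∷ J with sweep {m = 12 + m} c [] Cs 3≤z J Us
    where
    3≤z : 3 ≤ suc z
    3≤z = ≤-trans (m≤n⇒m≤1+n p) (m≤n⇒m≤1+n q)
  -- Without an exception there are `z` blocks, more than `x`; the 12 levels reserved for the other
  -- case are given up.
  ... | inj₂ (Gs , len , t , Vs , pairs , _) =
    c , x , Gs , ≤-trans (<⇒≤ q) (≤-reflexive (sym (trans len eq))) ,
    refl ∷ Sub.++⁺ʳ (concat Bs) (⊑-trans (z ∷ʳ t) s) ,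
    All.zipWith (λ (K , V) → tree-lower 12 K V)
      (increasing-concat (increasing-weaken (s≤s z≤n) (increasing-⊑ t J)) , Vs) ,
    pairs , Sub.All-resp-⊆ (z ∷ʳ t) h
  ... | inj₁ (x′ , Z , d , d≢c , t , V , h′) with increasing-⊑ t J
  ...   | q′ ∷ K
    with homogeneous-groups (≤-trans (m≤n⇒m≤1+n p) (≤-trans (m≤n⇒m≤1+n q) (m≤n⇒m≤1+n q′))) K V
  ...     | e , Gs , len , u , Ws , pairs with e Fin.≟ d
  ...       | yes refl =
    e , x′ , Gs , <⇒≤ len ,
    x ∷ʳ Sub.++⁺ʳ (concat Bs) (⊑-trans (⊑-trans (refl ∷ u) t) (⊑-trans (z ∷ʳ ⊑-refl) s)) ,
    All.map (λ W → _ , ⊑-refl , W) Ws , pairs , Sub.All-resp-⊆ u h′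
  -- Now `e` is `c`, the colour in which `x` sees all of these blocks, and there are more than `x′`
  -- of them, hence enough for `x`.
  ...       | no e≢d with two-colours d≢c e≢d
  ...         | refl =
    c , x , Gs , ≤-trans (<⇒≤ q) (≤-trans (≤-trans (n≤1+n z) q′) (<⇒≤ len)) ,
    refl ∷ Sub.++⁺ʳ (concat Bs) (⊑-trans sub s) ,
    All.map (λ W → _ , ⊑-refl , W) Ws , pairs , Sub.All-resp-⊆ sub h
    where
    sub : concat Gs ⊑ z ∷ concat Cs
    sub = z ∷ʳ ⊑-trans u (⊑-trans (x′ ∷ʳ ⊑-refl) t)

  -- Induction on the two target heights.

  HasHomogeneous : Fin 2 → ℕ → List ℕ → Set
  HasHomogeneous c n X = ∃ λ Y → Y ⊑ X × Tree id n Y × AllPairs (λ x y → P x y ≡ c) Y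

  hasHomogeneous-⊑ : ∀ {c} → Y ⊑ X → HasHomogeneous c n Y → HasHomogeneous c n X
  hasHomogeneous-⊑ s (Z , t , T , h) = Z , ⊑-trans t s , T , h

  cross-concat : ∀ {c} → All (Cross c X) Gs → Cross c X (concat Gs)
  cross-concat hs = All.tabulate λ x∈X → All.concat⁺ (All.map (λ h → All.lookup h x∈X) hs)

  homogeneous-union : ∀ {c} → AllPairs (Cross c) Gs → All (HasHomogeneous c n) Gs →
    ∃ λ Hs → length Hs ≡ length Gs × concat Hs ⊑ concat Gs × All (Tree id n) Hs ×
      AllPairs (λ x y → P x y ≡ c) (concat Hs)
  homogeneous-union []       []                   = [] , refl , [] , [] , []
  homogeneous-union (r ∷ rs) ((Y , s , T , h) ∷ hs) with homogeneous-union rs hs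
  ... | Hs , len , t , Ts , h′ =
    Y ∷ Hs , cong suc len , Sub.++⁺ s t , T ∷ Ts ,
    AllPairs.++⁺ h h′ (All.map (Sub.All-resp-⊆ t) (Sub.All-resp-⊆ s (cross-concat r)))

  homogeneous-node : ∀ {c x} → x ≤ length Gs → AllPairs (Cross c) Gs → Mono c x (concat Gs) →
    All (HasHomogeneous c n) Gs → HasHomogeneous c (suc n) (x ∷ concat Gs)
  homogeneous-node {x = x} len rs h hs with homogeneous-union rs hs
  ... | Hs , len′ , t , Ts , h′ =
    -- A node with root `x` has exactly `x` children, so any surplus is cut off.
    x ∷ concat (take x Hs) , refl ∷ ⊑-trans sub t ,
    node (trans (length-take x Hs) (m≤n⇒m⊓n≡m (≤-trans len (≤-reflexive (sym len′))))) (All.take⁺ x Ts) ,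
    Sub.All-resp-⊆ (⊑-trans sub t) h ∷ allPairs-⊑ sub h′
    where
    sub : concat (take x Hs) ⊑ concat Hs
    sub = concat-⊑ (Sub.take-⊆ x Hs)

  -- In the step, `(suc a + suc b) * 24` unfolds to the `24 + m` of `rooted-groups`, with `m` the
  -- height for a target lowered by one.
  homogeneous-subtree : ∀ a b → Increasing 3 X → Tree id ((a + b) * 24) X →
    HasHomogeneous 0F a X ⊎ HasHomogeneous 1F b X
  homogeneous-subtree zero b I T with tree-nonempty T
  ... | x , x∈X = inj₁ (x ∷ [] , from∈ x∈X , leaf , [] ∷ [])
  homogeneous-subtree (suc a) zero I T with tree-nonempty T
  ... | x , x∈X = inj₂ (x ∷ [] , from∈ x∈X , leaf , [] ∷ [])
  homogeneous-subtree {X} (suc a) (suc b) I T with rooted-groups I T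
  ... | zero , x , Gs , len , s , Cs , rs , h = Sum.map₁
      (hasHomogeneous-⊑ s ∘ homogeneous-node len rs h)
      (all-or (All.zipWith recurse (Cs , Sub.all⊆concat Gs)))
    where
    recurse : ∀ {G} → Contains ((a + suc b) * 24) G × G ⊑ concat Gs →
      HasHomogeneous 0F a G ⊎ HasHomogeneous 1F (suc b) X
    recurse ((Y , t , U) , u) = Sum.map (hasHomogeneous-⊑ t) (hasHomogeneous-⊑ v)
      (homogeneous-subtree a (suc b) (increasing-⊑ v I) U)
      where
      v : Y ⊑ X
      v = ⊑-trans (⊑-trans t u) (⊑-trans (x ∷ʳ ⊑-refl) s)
  ... | suc zero , x , Gs , len , s , Cs , rs , h = Sum.swap (Sum.map₁
      (hasHomogeneous-⊑ s ∘ homogeneous-node len rs h)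
      (all-or (All.zipWith recurse (Cs , Sub.all⊆concat Gs))))
    where
    recurse : ∀ {G} → Contains ((a + suc b) * 24) G × G ⊑ concat Gs →
      HasHomogeneous 1F b G ⊎ HasHomogeneous 0F (suc a) X
    recurse ((Y , t , U) , u) = Sum.swap (Sum.map (hasHomogeneous-⊑ v) (hasHomogeneous-⊑ t)
      (homogeneous-subtree (suc a) b (increasing-⊑ v I)
        (subst (λ e → Tree id (e * 24) Y) (+-suc a b) U)))
      where
      v : Y ⊑ X
      v = ⊑-trans (⊑-trans t u) (⊑-trans (x ∷ʳ ⊑-refl) s)

-- Return to finite sets and colourings of pairs.

allPairs-lookup : {R : ℕ → ℕ → Set} → AllPairs _<_ X → AllPairs R X → x ∈ X → y ∈ X → x < y → R x y
allPairs-lookup (_ ∷ _)  (_ ∷ _)  (here refl) (here refl) x<y = contradiction x<y (<-irrefl refl)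
allPairs-lookup (_ ∷ _)  (r ∷ _)  (here refl) (there y∈)  x<y = All.lookup r y∈
allPairs-lookup (i ∷ _)  (_ ∷ _)  (there x∈)  (here refl) x<y = contradiction x<y (<-asym (All.lookup i x∈))
allPairs-lookup (_ ∷ is) (_ ∷ rs) (there x∈)  (there y∈)  x<y = allPairs-lookup is rs x∈ y∈ x<y

-- Outside [ X ]² the extended colouring takes the junk value 0.
extend : ∀ {X} → ([ X ]² → Fin 2) → ℕ → ℕ → Fin 2
extend {X} P x y with x ∈? elements X | y ∈? elements X | x <? y
... | yes x∈ | yes y∈ | yes x<y = P (mkPair x y x∈ y∈ x<y)
... | _      | _      | _       = 0F

extend-≡ : ∀ {X} (P : [ X ]² → Fin 2) x y .(x∈ : x ∈ elements X) .(y∈ : y ∈ elements X) .(x<y : x < y) →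
  extend P x y ≡ P (mkPair x y x∈ y∈ x<y)
extend-≡ {X} P x y x∈ y∈ x<y with x ∈? elements X | y ∈? elements X | x <? y
... | yes _ | yes _ | yes _ = refl
... | no ¬p | _     | _     = ⊥-elim-irr (¬p x∈)
... | yes _ | no ¬p | _     = ⊥-elim-irr (¬p y∈)
... | yes _ | yes _ | no ¬p = ⊥-elim-irr (¬p x<y)

hasHomogeneous⇒homogeneous : ∀ {X} (P : [ X ]² → Fin 2) {c} → HasHomogeneous (extend P) c n (elements X) →
  Σ FiniteSet λ Y → Σ (Y ⊆ X) λ Y⊆X → Large (ω^ n) Y × Homogeneous {X} {Y} P Y⊆X
hasHomogeneous⇒homogeneous {n} {X} P {c} (Y , s , T , h) =
  mkFiniteSet Y increasingY , Sub.Any-resp-⊆ s , tree⇒large n T , c , monochromatic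
  where
  increasingY : AllPairs _<_ Y
  increasingY = allPairs-⊑ s (increasing X)
  monochromatic : (e : [ mkFiniteSet Y increasingY ]²) → P (include (Sub.Any-resp-⊆ s) e) ≡ c
  monochromatic (mkPair x y x∈ y∈ x<y) = trans
    (sym (extend-≡ P x y (Sub.Any-resp-⊆ s x∈) (Sub.Any-resp-⊆ s y∈) x<y))
    -- A pair holds these facts irrelevantly; being decidable, they can be recovered.
    (allPairs-lookup increasingY h (recompute (x ∈? Y) x∈) (recompute (y ∈? Y) y∈) (recompute (x <? y) x<y))

large⇒hasHomogeneous : ∀ (Q : ℕ → ℕ → Fin 2) j n .{o} → Increasing 3 X →
  foldl _[_] (mkOrdinal (j + (n + n) * 24 ∷ []) o) X ≡ 𝟎 →
  HasHomogeneous Q 0F n X ⊎ HasHomogeneous Q 1F n X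
large⇒hasHomogeneous Q j n I large with large⇒forest _ _ large
... | Y , s , F with increasing-⊑ s I
... | J with tree-lower j (increasing-weaken (s≤s z≤n) J) (forest-singleton F)
... | Z , t , T = Sum.map (hasHomogeneous-⊑ Q (⊑-trans t s)) (hasHomogeneous-⊑ Q (⊑-trans t s))
  (homogeneous-subtree Q n n (increasing-⊑ t J) T)

split-exponent : ∀ j k n → (j + (k + k)) * n ≡ j * n + (n + n) * k
split-exponent = solve 3 (λ j k n → (j :+ (k :+ k)) :* n := j :* n :+ (n :+ n) :* k) refl
  where open +-*-Solver

large⇒RT²₂-Large : ∀ {e} j n X → e ≡ j + (n + n) * 24 → All (3 ≤_) (elements X) →
  Large (ω^ e) X → RT²₂-Large (ω^ n) X
large⇒RT²₂-Large j n X refl 3≤X large P =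
  Sum.[ hasHomogeneous⇒homogeneous P , hasHomogeneous⇒homogeneous P ]
    (large⇒hasHomogeneous (extend P) j n (pairs-increasing 3≤X (increasing X)) large)

theorem1p6 : (n : ℕ) (X : FiniteSet) → All (3 ≤_) (elements X) → Large (ω^ (300 * n)) X → RT²₂-Large (ω^ n) X
-- Here 300 = 252 + 2 * 24: a target of height `n` in each colour takes `(n + n) * 24` levels.
theorem1p6 n X = large⇒RT²₂-Large (252 * n) n X (split-exponent 252 24 n)
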